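{- For integers $r\ge 2$ and $k\ge 1$, $\chi_l(K_{2r-1,r*(k-1)}^r)=k$.
   Context: All hypergraphs are finite. A vertex coloring of a hypergraph is proper if no edge is monochromatic. A $k$-list assignment $L$ assigns to each vertex $v$ a set $L(v)$ of exactly $k$ colors; an $L$-coloring is a proper coloring with each vertex $v$ colored from $L(v)$; $\chi_l(H)$ is the least $k$ such that $H$ is $L$-colorable for every $k$-list assignment $L$. For positive integers $p_1,\dots,p_k$ and disjoint sets $V_1,\dots,V_k$ with $|V_i|=p_i$, the hypergraph $K^r_{p_1,\dots,p_k}$ has vertex set $V_1\cup\cdots\cup V_k$ and edge set consisting of all $r$-subsets $S$ of the vertex set with $S\not\subseteq V_i$ for every $i$. $K_{2r-1,r*(k-1)}^r$ denotes this hypergraph with one part of size $2r-1$ and $k-1$ parts of size $r$. -}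

module Defs where

open import Data.Nat using (ℕ; zero; suc; _+_; _*_; _∸_; _<_)
open import Data.List using (List; []; _∷_; length; replicate)
open import Data.Nat.ListAction using (sum)
open import Data.List.Relation.Unary.Unique.Propositional using (Unique)
open import Data.List.Membership.Propositional using () renaming (_∈_ to _∈ˡ_)
open import Data.Fin using (Fin; splitAt)
open import Data.Fin.Subset using (Subset; _∈_; ∣_∣)
open import Data.Sum using (inj₁; inj₂)
open import Data.Product using (Σ; ∃; _×_)
open import Relation.Nullary using (¬_)
open import Relation.Binary.PropositionalEquality using (_≡_)

record Hypergraph : Set₁ where
  field
    n    : ℕ
    Edge : Subset n → Set
open Hypergraph public

Coloring : Hypergraph → Set
Coloring H = Fin (n H) → ℕ

Monochromatic : {m : ℕ} → (Fin m → ℕ) → Subset m → Set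
Monochromatic c S = ∃ λ a → ∀ v → v ∈ S → c v ≡ a

Proper : (H : Hypergraph) → Coloring H → Set
Proper H c = ∀ S → Edge H S → ¬ Monochromatic c S

ListAssignment : Hypergraph → Set
ListAssignment H = Fin (n H) → List ℕ

IsKListAssignment : (H : Hypergraph) → ℕ → ListAssignment H → Set
IsKListAssignment H k L = ∀ v → Unique (L v) × length (L v) ≡ k

LColorable : (H : Hypergraph) → ListAssignment H → Set
LColorable H L = Σ (Coloring H) λ c → (∀ v → c v ∈ˡ L v) × Proper H c

Choosable : Hypergraph → ℕ → Set
Choosable H k = ∀ L → IsKListAssignment H k L → LColorable H L

ListChromaticNumber≡ : Hypergraph → ℕ → Set
ListChromaticNumber≡ H k = Choosable H k × (∀ m → m < k → ¬ Choosable H m)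

-- Part index of a vertex of Fin (p₁ + ... + p_k): vertices of the i-th part
-- (0-based) are the consecutive block of size pᵢ.
partOf : (p : List ℕ) → Fin (sum p) → ℕ
partOf (a ∷ ps) v with splitAt a v
... | inj₁ _ = zero
... | inj₂ w = suc (partOf ps w)

CompleteMultipartite : (r : ℕ) → List ℕ → Hypergraph
CompleteMultipartite r p = record
  { n    = sum p
  ; Edge = λ S → ∣ S ∣ ≡ r × (∀ i → ¬ (∀ v → v ∈ S → partOf p v ≡ i))
  }

K : (r k : ℕ) → Hypergraph
K r k = CompleteMultipartite r ((2 * r ∸ 1) ∷ replicate (k ∸ 1) r)

{-# OPTIONS --safe #-}
-- Choosability is proved for vertex sets A covered by a set W of size at most 2r - 1 and q sets
-- P j of size at most r, with lists of q + 1 colours. A colour class is harmless if it has at most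
-- s = r - 1 vertices or lies in W or in some P j. If some colour is common to all of A ∩ P j, use
-- it there and drop P j. Otherwise, if Hall's condition with capacity s holds, every class can be
-- made small. If it fails on a proper subset T of A, take T as large as possible: T is coloured by
-- induction, and the other vertices by Hall's theorem from the colours that T does not see.
-- If it fails only on A itself, let c be the colour in the most lists of A ∩ W; counting the pairs
-- of a vertex and a colour in its list shows that once c is given to all these vertices, Hall's
-- condition holds for the rest.
--
-- For the lower bound, let all lists be {0, …, m - 1}. Take r vertices of the large part and all
-- vertices of the other parts; each colour occurs at most r times among these k r vertices.
module Submission where

open import Defs renaming (n to order)
open import Data.Nat using (ℕ; _≤_)
open import Data.Nat using (zero; suc; _+_; _*_; _∸_; _<_; z≤n; s≤s; s≤s⁻¹)
open import Data.Nat.Properties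
open import Data.Bool using (Bool; true; false; _∧_; _∨_; not; if_then_else_)
open import Data.Bool.Properties using (∧-conicalˡ; ∧-conicalʳ)
import Data.Bool.Properties as Bool
open import Data.Fin using (Fin; zero; suc; punchIn; punchOut; toℕ; fromℕ<; splitAt; _↑ˡ_; _↑ʳ_)
open import Data.Fin.Properties using (any?; punchIn-punchOut; splitAt-↑ˡ; splitAt-↑ʳ; toℕ-fromℕ<; toℕ-injective)
  renaming (_≟_ to _≟ᶠ_)
open import Data.Fin.Subset using (Subset; ∣_∣) renaming (_∈_ to _∈ˢ_)
open import Data.List using (List; []; _∷_; length; replicate; concat; upTo) renaming (tabulate to tabulateˡ)
open import Data.List.Extrema.Nat using (max; xs≤max)
open import Data.List.Membership.DecPropositional _≟_ using (_∈?_) renaming (_∈_ to _∈ˡ_)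
open import Data.List.Membership.Propositional.Properties using (∈-concat⁺′; ∈-tabulate⁺; ∈-upTo⁻)
open import Data.List.Properties using (length-replicate; length-upTo)
open import Data.List.Relation.Unary.All using () renaming (lookup to lookupᴬ)
open import Data.List.Relation.Unary.AllPairs using ([]; _∷_)
open import Data.List.Relation.Unary.Any using (here; there)
open import Data.List.Relation.Unary.Unique.Propositional using (Unique)
open import Data.List.Relation.Unary.Unique.Propositional.Properties using (upTo⁺)
open import Data.Nat.ListAction using () renaming (sum to sumˡ)
open import Data.Nat.Tactic.RingSolver using (solve-∀)
open import Data.Product using (Σ; ∃; _×_; _,_; proj₁; proj₂)
open import Data.Sum using (_⊎_; inj₁; inj₂)
open import Data.Vec using ([]; _∷_; lookup; tabulate)
open import Data.Vec.Properties using (lookup∘tabulate; []=⇒lookup; lookup⇒[]=)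
open import Function using (_∘_)
open import Relation.Binary.PropositionalEquality
open import Relation.Nullary using (¬_; Dec; yes; no; does; contradiction)
open import Relation.Nullary.Decidable using (dec-true; dec-false; _×-dec_; ¬?)
open import Algebra.Properties.CommutativeMonoid.Sum +-0-commutativeMonoid
  using (sum; ∑-distrib-+; ∑-comm; sum-replicate-zero)
open import Algebra.Properties.Semiring.Sum +-*-semiring using (*-distribʳ-sum)

private
  variable
    n m k t : ℕ

does-true : ∀ {a} {P : Set a} (P? : Dec P) → does P? ≡ true → P
does-true (yes p) _ = p

-- Finite sets

FSet : ℕ → Set
FSet n = Fin n → Bool

private
  variable
    A B C D : FSet n
    u v : Fin n

infix 4 _∈_ _∉_ _⊆_
infixr 7 _∩_
infixr 6 _∪_
infixl 6 _─_

_∈_ _∉_ : Fin n → FSet n → Set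
v ∈ A = A v ≡ true
v ∉ A = A v ≡ false

_⊆_ : FSet n → FSet n → Set
A ⊆ B = ∀ {v} → v ∈ A → v ∈ B

-- The set operations are opaque so that unification can read off their arguments.
opaque

  _∩_ _∪_ _─_ : FSet n → FSet n → FSet n
  (A ∩ B) v = A v ∧ B v
  (A ∪ B) v = A v ∨ B v
  (A ─ B) v = A v ∧ not (B v)

  ∅ : FSet n
  ∅ _ = false

  ⁅_⁆ : Fin n → FSet n
  ⁅ v ⁆ u = does (u ≟ᶠ v)

  ∩⁺ : v ∈ A → v ∈ B → v ∈ A ∩ B
  ∩⁺ p q rewrite p | q = refl

  ∩⁻ : v ∈ A ∩ B → v ∈ A × v ∈ B
  ∩⁻ e = ∧-conicalˡ _ _ e , ∧-conicalʳ _ _ e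

  ∪⁺ˡ : v ∈ A → v ∈ A ∪ B
  ∪⁺ˡ {v = v} {A = A} e with true ← A v = refl

  ∪⁺ʳ : v ∈ B → v ∈ A ∪ B
  ∪⁺ʳ {v = v} {A = A} e with A v
  ... | true  = refl
  ... | false = e

  ∪⁻ : v ∈ A ∪ B → v ∈ A ⊎ v ∈ B
  ∪⁻ {v = v} {A = A} e with A v
  ... | true  = inj₁ refl
  ... | false = inj₂ e

  ─⁺ : v ∈ A → v ∉ B → v ∈ A ─ B
  ─⁺ p q rewrite p | q = refl

  ─⁻ : v ∈ A ─ B → v ∈ A × v ∉ B
  ─⁻ {v = v} {A = A} {B = B} e with true ← A v | false ← B v = refl , refl

  ∅⁻ : ¬ v ∈ ∅
  ∅⁻ ()

  self∈⁅⁆ : (v : Fin n) → v ∈ ⁅ v ⁆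
  self∈⁅⁆ v = dec-true (v ≟ᶠ v) refl

  ∈⁅⁆⁻ : u ∈ ⁅ v ⁆ → u ≡ v
  ∈⁅⁆⁻ = does-true (_ ≟ᶠ _)

∈-∉ : v ∈ A → v ∉ A → ∀ {ℓ} {X : Set ℓ} → X
∈-∉ p q with () ← trans (sym p) q

∈-or-∉ : ∀ (A : FSet n) v → v ∈ A ⊎ v ∉ A
∈-or-∉ A v with A v
... | true  = inj₁ refl
... | false = inj₂ refl

⊆-or-witness : (A B : FSet n) → A ⊆ B ⊎ ∃ λ v → v ∈ A × v ∉ B
⊆-or-witness A B with any? (λ v → (A v Bool.≟ true) ×-dec (B v Bool.≟ false))
... | yes w = inj₂ w
... | no ¬w = inj₁ inB
  where
  inB : A ⊆ B
  inB {v} p with ∈-or-∉ B v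
  ... | inj₁ q = q
  ... | inj₂ q = contradiction (v , p , q) ¬w

-- Cardinality

𝟙 : Bool → ℕ
𝟙 true  = 1
𝟙 false = 0

opaque

  #_ : FSet n → ℕ
  # A = sum (𝟙 ∘ A)

  #≡sum : (A : FSet n) → # A ≡ sum (𝟙 ∘ A)
  #≡sum A = refl

infix 8 #_

sum-mono : {f g : Fin n → ℕ} → (∀ i → f i ≤ g i) → sum f ≤ sum g
sum-mono {zero}  h = z≤n
sum-mono {suc n} h = +-mono-≤ (h zero) (sum-mono (h ∘ suc))

sum-const : ∀ n (k : ℕ) → sum {n} (λ _ → k) ≡ n * k
sum-const zero    k = refl
sum-const (suc n) k = cong (k +_) (sum-const n k)

opaque
  unfolding #_

  -- The indicators are compared point by point. Taking a union and an intersection for `C` and `D`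
  -- gives the counting step for two sets; `uncross` also needs the form for two neighbourhoods,
  -- where `C` and `D` are arbitrary sets.
  #-mono₂ : (∀ {v} → v ∈ A → v ∈ C ⊎ v ∈ D) → (∀ {v} → v ∈ B → v ∈ C ⊎ v ∈ D) →
            (∀ {v} → v ∈ A → v ∈ B → v ∈ C × v ∈ D) → # A + # B ≤ # C + # D
  #-mono₂ {A = A} {C = C} {D = D} {B = B} p q r = begin
    # A + # B                        ≡⟨ ∑-distrib-+ (𝟙 ∘ A) (𝟙 ∘ B) ⟨
    sum (λ v → 𝟙 (A v) + 𝟙 (B v))    ≤⟨ sum-mono pointwise ⟩
    sum (λ v → 𝟙 (C v) + 𝟙 (D v))    ≡⟨ ∑-distrib-+ (𝟙 ∘ C) (𝟙 ∘ D) ⟩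
    # C + # D                        ∎
    where
    open ≤-Reasoning
    pos : ∀ {c d} → c ≡ true ⊎ d ≡ true → 1 ≤ 𝟙 c + 𝟙 d
    pos (inj₁ refl) = s≤s z≤n
    pos {true}  (inj₂ refl) = s≤s z≤n
    pos {false} (inj₂ refl) = s≤s z≤n
    pointwise : ∀ v → 𝟙 (A v) + 𝟙 (B v) ≤ 𝟙 (C v) + 𝟙 (D v)
    pointwise v with A v in a | B v in b
    ... | false | false = z≤n
    ... | true  | false = pos (p a)
    ... | false | true  = pos (q b)
    ... | true  | true  with r a b
    ...   | c , d rewrite c | d = ≤-refl

  #-mono : A ⊆ B → # A ≤ # B
  #-mono {A = A} {B = B} p = sum-mono pointwise
    where
    pointwise : ∀ v → 𝟙 (A v) ≤ 𝟙 (B v)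
    pointwise v with A v in a
    ... | false = z≤n
    ... | true rewrite p a = ≤-refl

opaque
  unfolding #_ ∅

  #-∅ : # ∅ {n} ≡ 0
  #-∅ {n} = sum-replicate-zero n

  #-⁅⁆ : (v : Fin n) → # ⁅ v ⁆ ≡ 1
  #-⁅⁆ {suc n} zero    = cong suc (sum-replicate-zero n)
  #-⁅⁆ {suc n} (suc v) = #-⁅⁆ v

#-subadditive : (∀ {v} → v ∈ A → v ∈ C ⊎ v ∈ D) → # A ≤ # C + # D
#-subadditive {A = A} p = ≤-trans (m≤m+n (# A) (# ∅)) (#-mono₂ p (λ e → contradiction e ∅⁻) (λ _ e → contradiction e ∅⁻))

#-superadditive : A ⊆ C → B ⊆ C → (∀ {v} → v ∈ A → v ∉ B) → # A + # B ≤ # C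
#-superadditive {A = A} {C = C} {B = B} p q r = begin
  # A + # B     ≤⟨ #-mono₂ (λ a → inj₁ (p a)) (λ b → inj₁ (q b)) (λ a b → ∈-∉ {A = B} b (r a)) ⟩
  # C + # ∅     ≡⟨ cong (# C +_) #-∅ ⟩
  # C + 0       ≡⟨ +-identityʳ _ ⟩
  # C           ∎
  where open ≤-Reasoning

#<⇒witness : # A < # B → ∃ λ v → v ∈ B × v ∉ A
#<⇒witness {A = A} {B = B} lt with ⊆-or-witness B A
... | inj₂ w = w
... | inj₁ B⊆A = contradiction (#-mono {A = B} {B = A} B⊆A) (<⇒≱ lt)

0<#⇒nonempty : 0 < # A → ∃ λ v → v ∈ A
0<#⇒nonempty {A = A} lt
  with v , p , _ ← #<⇒witness {A = ∅} {B = A} (subst (_< # A) (sym #-∅) lt) = v , p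

empty⇒#≡0 : (∀ {v} → ¬ v ∈ A) → # A ≡ 0
empty⇒#≡0 {A = A} none = n≤0⇒n≡0 (subst (# A ≤_) #-∅ (#-mono {A = A} (λ p → contradiction p none)))

⊂⇒#< : A ⊆ B → v ∈ B → v ∉ A → # A < # B
⊂⇒#< {A = A} {B = B} {v = v} A⊆B p q = begin
  1 + # A         ≡⟨ cong (_+ # A) (#-⁅⁆ v) ⟨
  # ⁅ v ⁆ + # A   ≤⟨ #-superadditive (λ e → subst (_∈ B) (sym (∈⁅⁆⁻ e)) p) A⊆B
                       (λ e → subst (_∉ A) (sym (∈⁅⁆⁻ e)) q) ⟩
  # B             ∎
  where open ≤-Reasoning

#≤⇒⊇ : A ⊆ B → # B ≤ # A → B ⊆ A
#≤⇒⊇ {A = A} {B = B} A⊆B le with ⊆-or-witness B A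
... | inj₁ B⊆A = B⊆A
... | inj₂ (v , p , q) = contradiction le (<⇒≱ (⊂⇒#< {A = A} {B = B} A⊆B p q))

#-─ : (A B : FSet n) → # A ≤ # (A ∩ B) + # (A ─ B)
#-─ A B = #-subadditive split
  where
  split : ∀ {v} → v ∈ A → v ∈ A ∩ B ⊎ v ∈ A ─ B
  split {v} p with ∈-or-∉ B v
  ... | inj₁ e = inj₁ (∩⁺ p e)
  ... | inj₂ e = inj₂ (─⁺ p e)

-- Induction on `q`: once `P zero` is removed from `A`, the rest is covered by `W` and the later
-- sets. The covering sets may overlap.
#-cover : ∀ {q} (P : Fin q → FSet n) (W A : FSet n) →
          (∀ {v} → v ∈ A → v ∈ W ⊎ ∃ λ j → v ∈ P j) →
          # A ≤ # (A ∩ W) + sum (λ j → # (A ∩ P j))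
#-cover {q = zero} P W A cov = ≤-trans (#-mono inW) (m≤m+n _ 0)
  where
  inW : A ⊆ A ∩ W
  inW p with inj₁ w ← cov p = ∩⁺ p w
#-cover {q = suc q} P W A cov = begin
  # A                                         ≤⟨ #-─ A (P zero) ⟩
  p₀ + # A′                                   ≤⟨ +-monoʳ-≤ p₀ (#-cover (P ∘ suc) W A′ cov′) ⟩
  p₀ + (# (A′ ∩ W) + sum (λ j → # (A′ ∩ P (suc j))))
    ≤⟨ +-monoʳ-≤ p₀ (+-mono-≤ (shrink W) (sum-mono (λ j → shrink (P (suc j))))) ⟩
  p₀ + (# (A ∩ W) + ps)                       ≡⟨ +-assoc p₀ (# (A ∩ W)) ps ⟨
  p₀ + # (A ∩ W) + ps                         ≡⟨ cong (_+ ps) (+-comm p₀ (# (A ∩ W))) ⟩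
  # (A ∩ W) + p₀ + ps                         ≡⟨ +-assoc (# (A ∩ W)) p₀ ps ⟩
  # (A ∩ W) + (p₀ + ps)                       ∎
  where
  open ≤-Reasoning
  A′ = A ─ P zero
  p₀ = # (A ∩ P zero)
  ps = sum (λ j → # (A ∩ P (suc j)))
  cov′ : ∀ {v} → v ∈ A′ → v ∈ W ⊎ ∃ λ j → v ∈ P (suc j)
  cov′ p with a , b ← ─⁻ p with cov a
  ... | inj₁ w           = inj₁ w
  ... | inj₂ (zero  , e) = ∈-∉ {A = P zero} e b
  ... | inj₂ (suc j , e) = inj₂ (j , e)
  shrink : ∀ B → # (A′ ∩ B) ≤ # (A ∩ B)
  shrink B = #-mono λ e → let a , b = ∩⁻ e in ∩⁺ (proj₁ (─⁻ a)) b

-- Bipartite graphs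

opaque

  -- The neighbourhood of `T` in the bipartite graph that joins each vertex to the colours in its
  -- list.
  N : (Fin n → FSet m) → FSet n → FSet m
  N L T c = does (any? λ v → (T ∩ λ u → L u c) v Bool.≟ true)

  N⁺ : ∀ {L : Fin n → FSet m} {T v c} → v ∈ T → c ∈ L v → c ∈ N L T
  N⁺ {v = v} p q = dec-true (any? _) (v , ∩⁺ p q)

  N⁻ : ∀ {L : Fin n → FSet m} {T c} → c ∈ N L T → ∃ λ v → v ∈ T × c ∈ L v
  N⁻ e with v , p ← does-true (any? _) e = v , ∩⁻ p

module _ (L : Fin n → FSet m) where

  N-mono : ∀ {S T} → S ⊆ T → N L S ⊆ N L T
  N-mono S⊆T e with v , p , q ← N⁻ e = N⁺ (S⊆T p) q

  opaque
    unfolding _∩_ #_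

    -- The pairs of a vertex of `X` and a colour in its list are counted by rows and by columns. A
    -- column outside `Y` is empty.
    double-count : ∀ X Y → (∀ {v} → v ∈ X → k ≤ # L v) →
                   (∀ {v c} → v ∈ X → c ∈ L v → c ∈ Y) →
                   (∀ c → # (X ∩ λ v → L v c) ≤ t) → # X * k ≤ # Y * t
    double-count {k = k} {t = t} X Y big into small = begin
      # X * k                                   ≡⟨ *-distribʳ-sum k (𝟙 ∘ X) ⟩
      sum (λ v → 𝟙 (X v) * k)                   ≤⟨ sum-mono row ⟩
      sum (λ v → sum (λ c → 𝟙 (X v ∧ L v c)))   ≡⟨ ∑-comm (λ v c → 𝟙 (X v ∧ L v c)) ⟩
      sum (λ c → sum (λ v → 𝟙 (X v ∧ L v c)))   ≤⟨ sum-mono column ⟩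
      sum (λ c → 𝟙 (Y c) * t)                   ≡⟨ *-distribʳ-sum t (𝟙 ∘ Y) ⟨
      # Y * t                                   ∎
      where
      open ≤-Reasoning
      row : ∀ v → 𝟙 (X v) * k ≤ sum (λ c → 𝟙 (X v ∧ L v c))
      row v with X v in x
      ... | false = z≤n
      ... | true  = ≤-trans (≤-reflexive (+-identityʳ k)) (big x)
      column : ∀ c → # (X ∩ λ v → L v c) ≤ 𝟙 (Y c) * t
      column c with Y c in y
      ... | true  = ≤-trans (small c) (≤-reflexive (sym (+-identityʳ t)))
      ... | false = ≤-reflexive (empty⇒#≡0 {A = X ∩ λ v → L v c} λ e →
                      let a , b = ∩⁻ {A = X} {B = λ v → L v c} e in ∈-∉ {A = Y} (into a b) y)

-- Hall's theorem with capacities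

sum-mono-< : {f g : Fin n → ℕ} → (∀ i → f i ≤ g i) → (j : Fin n) → f j < g j → sum f < sum g
sum-mono-< h zero    lt = +-mono-<-≤ lt (sum-mono (h ∘ suc))
sum-mono-< h (suc j) lt = +-mono-≤-< (h zero) (sum-mono-< (h ∘ suc) j lt)

fibre : (Fin n → Fin m) → Fin m → FSet n
fibre f c v = ⁅ c ⁆ (f v)

-- The palette is nonempty because vertices outside A are assigned junk colours.
Assignment : FSet n → (Fin n → FSet (suc m)) → ℕ → Set
Assignment {n} {m} A L s = Σ (Fin n → Fin (suc m)) λ f →
  (∀ {v} → v ∈ A → f v ∈ L v) × (∀ c → # (A ∩ fibre f c) ≤ s)

Violator : FSet n → (Fin n → FSet m) → ℕ → Set
Violator A L s = ∃ λ T → T ⊆ A × # (N L T) * s < # T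

opaque

  delete : (Fin n → FSet m) → Fin n → Fin m → Fin n → FSet m
  delete L v x u = L u ─ (if does (u ≟ᶠ v) then ⁅ x ⁆ else ∅)

  delete⁻ : ∀ {L : Fin n → FSet m} {x c} → c ∈ delete L v x u → c ∈ L u
  delete⁻ = proj₁ ∘ ─⁻

  ∈-delete-≢ᵛ : ∀ {L : Fin n → FSet m} {x c} → c ∈ L u → ¬ u ≡ v → c ∈ delete L v x u
  ∈-delete-≢ᵛ {u = u} {v = v} p u≢v with u ≟ᶠ v
  ... | yes e = contradiction e u≢v
  ... | no  _ with ∈-or-∉ ∅ _
  ...   | inj₁ e = contradiction e ∅⁻
  ...   | inj₂ e = ─⁺ p e

  ∈-delete-≢ᶜ : ∀ {L : Fin n → FSet m} {x c} → c ∈ L u → ¬ c ≡ x → c ∈ delete L v x u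
  ∈-delete-≢ᶜ {u = u} {v = v} {x = x} {c = c} p c≢x with ∈-or-∉ (if does (u ≟ᶠ v) then ⁅ x ⁆ else ∅) c
  ... | inj₂ e = ─⁺ p e
  ... | inj₁ e with u ≟ᶠ v
  ...   | yes _ = contradiction (∈⁅⁆⁻ e) c≢x
  ...   | no  _ = contradiction e ∅⁻

  ∉-delete : ∀ {L : Fin n → FSet m} {x} → x ∉ delete L v x v
  ∉-delete {v = v} {L = L} {x = x} with ∈-or-∉ (delete L v x v) x
  ... | inj₂ e = e
  ... | inj₁ e with _ , e′ ← ─⁻ e rewrite dec-true (v ≟ᶠ v) refl = ∈-∉ {A = ⁅ x ⁆} (self∈⁅⁆ x) e′

N-⁅⁆ : ∀ {L : Fin n → FSet m} {c} → c ∈ N L ⁅ v ⁆ → c ∈ L v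
N-⁅⁆ {L = L} {c} e with w , p , q ← N⁻ e = subst (λ z → c ∈ L z) (∈⁅⁆⁻ p) q

pick : FSet (suc m) → Fin (suc m)
pick A with any? (λ c → A c Bool.≟ true)
... | yes (c , _) = c
-- A junk value for the empty set.
... | no _        = zero

∈-pick : ∀ {A : FSet (suc m)} → ¬ ¬ (∃ λ c → c ∈ A) → pick A ∈ A
∈-pick {A = A} ne with any? (λ c → A c Bool.≟ true)
... | yes (_ , e) = e
... | no none     = contradiction none ne

module _ {A : FSet n} {L : Fin n → FSet (suc m)} {s : ℕ} where

  singleton-violator : v ∈ A → (∀ {c} → ¬ c ∈ L v) → Violator A L s
  singleton-violator {v = v} p none = ⁅ v ⁆ , (λ e → subst (_∈ A) (sym (∈⁅⁆⁻ e)) p) , (begin-strict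
    # (N L ⁅ v ⁆) * s  ≡⟨ cong (_* s) (empty⇒#≡0 (none ∘ N-⁅⁆)) ⟩
    0                  <⟨ n<1+n 0 ⟩
    1                  ≡⟨ #-⁅⁆ v ⟨
    # ⁅ v ⁆            ∎)
    where open ≤-Reasoning

  -- The end of the edge deletion: the colour of each vertex is forced. A vertex with an empty list
  -- is a violator by itself, and a class of more than `s` vertices is one because its only
  -- neighbour is its colour.
  hall-one-colour : (∀ {v x y} → v ∈ A → x ∈ L v → y ∈ L v → x ≡ y) → Assignment A L s ⊎ Violator A L s
  hall-one-colour unique with any? (λ v → (A v Bool.≟ true) ×-dec ¬? (any? λ c → L v c Bool.≟ true))
  ... | yes (v , p , none) = inj₂ (singleton-violator p (λ e → none (_ , e)))
  ... | no ¬none with any? (λ c → s <? # (A ∩ fibre (pick ∘ L) c))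
  ...   | no ¬big = inj₁ (pick ∘ L , pick∈ , λ c → ≮⇒≥ λ lt → ¬big (c , lt))
    where
    pick∈ : ∀ {v} → v ∈ A → pick (L v) ∈ L v
    pick∈ {v} p = ∈-pick {A = L v} λ none → ¬none (v , p , none)
  ...   | yes (c , big) = inj₂ (A ∩ fibre (pick ∘ L) c , (proj₁ ∘ ∩⁻) , (begin-strict
    # (N L (A ∩ fibre (pick ∘ L) c)) * s  ≤⟨ *-monoˡ-≤ s (#-mono N⊆) ⟩
    # ⁅ c ⁆ * s                           ≡⟨ cong (_* s) (#-⁅⁆ c) ⟩
    1 * s                                 ≡⟨ *-identityˡ s ⟩
    s                                     <⟨ big ⟩
    # (A ∩ fibre (pick ∘ L) c)            ∎))
    where
    open ≤-Reasoning
    N⊆ : N L (A ∩ fibre (pick ∘ L) c) ⊆ ⁅ c ⁆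
    N⊆ e with v , p , q ← N⁻ e with a , b ← ∩⁻ p =
      subst (_∈ ⁅ c ⁆) (unique a (∈-pick {A = L v} λ none → none (_ , q)) q) b

  -- Rado's edge deletion: if deleting either of two edges at v creates a violator,
  -- then, by submodularity of the neighbourhood size, the union of the two violators
  -- or their intersection without v already is one.
  uncross : ∀ {v x y} → x ∈ L v → y ∈ L v → ¬ x ≡ y →
            Violator A (delete L v x) s → Violator A (delete L v y) s → Violator A L s
  uncross {v} {x} {y} x∈ y∈ x≢y (T₁ , T₁⊆A , big₁) (T₂ , T₂⊆A , big₂) with ∈-or-∉ T₁ v | ∈-or-∉ T₂ v
  -- The deletion affects only the list of `v`, so a violator that avoids `v` was one before.
  ... | inj₂ v∉T₁ | _ = T₁ , T₁⊆A , ≤-<-trans (*-monoˡ-≤ s (#-mono N⊆)) big₁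
    where
    N⊆ : N L T₁ ⊆ N (delete L v x) T₁
    N⊆ e with u , p , q ← N⁻ e = N⁺ p (∈-delete-≢ᵛ q λ { refl → ∈-∉ {A = T₁} p v∉T₁ })
  ... | inj₁ _ | inj₂ v∉T₂ = T₂ , T₂⊆A , ≤-<-trans (*-monoˡ-≤ s (#-mono N⊆)) big₂
    where
    N⊆ : N L T₂ ⊆ N (delete L v y) T₂
    N⊆ e with u , p , q ← N⁻ e = N⁺ p (∈-delete-≢ᵛ q λ { refl → ∈-∉ {A = T₂} p v∉T₂ })
  ... | inj₁ v∈T₁ | inj₁ v∈T₂ with # (N L (T₁ ∪ T₂)) * s <? # (T₁ ∪ T₂)
                                 | # (N L (T₁ ∩ T₂ ─ ⁅ v ⁆)) * s <? # (T₁ ∩ T₂ ─ ⁅ v ⁆)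
  ...   | yes big | _       = T₁ ∪ T₂ , U⊆A , big
    where
    U⊆A : T₁ ∪ T₂ ⊆ A
    U⊆A e with ∪⁻ e
    ... | inj₁ p = T₁⊆A p
    ... | inj₂ p = T₂⊆A p
  ...   | no _    | yes big = T₁ ∩ T₂ ─ ⁅ v ⁆ , (T₁⊆A ∘ proj₁ ∘ ∩⁻ ∘ proj₁ ∘ ─⁻) , big
  -- Discarding `v` from the intersection costs one vertex, but the two strict violations together
  -- leave a surplus of two.
  ...   | no ¬U   | no ¬I   = contradiction (≤-refl {# T₁ + # T₂}) (<⇒≱ (begin-strict
    # T₁ + # T₂                             ≤⟨ #-mono₂ (inj₁ ∘ ∪⁺ˡ) (inj₁ ∘ ∪⁺ʳ) (λ p q → ∪⁺ˡ p , ∩⁺ p q) ⟩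
    # (T₁ ∪ T₂) + # (T₁ ∩ T₂)               ≤⟨ +-monoʳ-≤ (# (T₁ ∪ T₂)) (#-─ (T₁ ∩ T₂) ⁅ v ⁆) ⟩
    # (T₁ ∪ T₂) + (# ((T₁ ∩ T₂) ∩ ⁅ v ⁆) + # I)
      ≤⟨ +-monoʳ-≤ (# (T₁ ∪ T₂)) (+-monoˡ-≤ (# I) (≤-trans (#-mono (proj₂ ∘ ∩⁻)) (≤-reflexive (#-⁅⁆ v)))) ⟩
    # (T₁ ∪ T₂) + (1 + # I)                 ≡⟨ +-suc _ _ ⟩
    suc (# (T₁ ∪ T₂) + # I)                 ≤⟨ s≤s (+-mono-≤ (≮⇒≥ ¬U) (≮⇒≥ ¬I)) ⟩
    suc (# (N L (T₁ ∪ T₂)) * s + # (N L I) * s)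
                                            ≡⟨ cong suc (*-distribʳ-+ s (# (N L (T₁ ∪ T₂))) (# (N L I))) ⟨
    suc ((# (N L (T₁ ∪ T₂)) + # (N L I)) * s)
      ≤⟨ s≤s (*-monoˡ-≤ s (#-mono₂ N-U N-I₁ (λ _ e → N-I e))) ⟩
    suc ((# N₁ + # N₂) * s)                 ≡⟨ cong suc (*-distribʳ-+ s (# N₁) (# N₂)) ⟩
    suc (# N₁ * s + # N₂ * s)               <⟨ ≤-trans (≤-reflexive (cong suc (sym (+-suc _ _)))) (+-mono-≤ big₁ big₂) ⟩
    # T₁ + # T₂                             ∎))
    where
    open ≤-Reasoning
    I = T₁ ∩ T₂ ─ ⁅ v ⁆
    N₁ = N (delete L v x) T₁
    N₂ = N (delete L v y) T₂
    N-I : ∀ {c} → c ∈ N L I → c ∈ N₁ × c ∈ N₂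
    N-I e with u , p , q ← N⁻ e with p′ , u∉ ← ─⁻ p with p₁ , p₂ ← ∩⁻ p′ =
      N⁺ p₁ (∈-delete-≢ᵛ q u≢v) , N⁺ p₂ (∈-delete-≢ᵛ q u≢v)
      where
      u≢v : ¬ u ≡ v
      u≢v refl = ∈-∉ {A = ⁅ v ⁆} (self∈⁅⁆ v) u∉
    N-I₁ : ∀ {c} → c ∈ N L I → c ∈ N₁ ⊎ c ∈ N₂
    N-I₁ = inj₁ ∘ proj₁ ∘ N-I
    -- The colour `x` deleted at `v` for `T₁` is still seen by `v` as a member of `T₂`, where only
    -- `y` was deleted, and conversely.
    N-U : ∀ {c} → c ∈ N L (T₁ ∪ T₂) → c ∈ N₁ ⊎ c ∈ N₂
    N-U {c} e with u , p , q ← N⁻ e with ∪⁻ p | c ≟ᶠ x | c ≟ᶠ y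
    ... | inj₁ p₁ | no c≢x   | _        = inj₁ (N⁺ p₁ (∈-delete-≢ᶜ q c≢x))
    ... | inj₁ p₁ | yes refl | _        = inj₂ (N⁺ v∈T₂ (∈-delete-≢ᶜ x∈ x≢y))
    ... | inj₂ p₂ | _        | no c≢y   = inj₂ (N⁺ p₂ (∈-delete-≢ᶜ q c≢y))
    ... | inj₂ p₂ | _        | yes refl = inj₁ (N⁺ v∈T₁ (∈-delete-≢ᶜ y∈ (x≢y ∘ sym)))

weaken-assignment : ∀ {L L′ : Fin n → FSet (suc m)} {s} → (∀ u c → c ∈ L′ u → c ∈ L u) →
                    Assignment A L′ s → Assignment A L s
weaken-assignment L′⊆L (f , f∈ , small) = f , (λ p → L′⊆L _ _ (f∈ p)) , small

-- Induction on the number of edges. While some vertex of `A` has two colours, either of the two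
-- edges may be deleted; if both deletions produce violators, `uncross` turns them into one for `L`.
hall : (A : FSet n) (L : Fin n → FSet (suc m)) (s : ℕ) → Assignment A L s ⊎ Violator A L s
hall {n} {m} A L s = go _ L ≤-refl
  where
  go : ∀ e (L : Fin n → FSet (suc m)) → sum (λ v → # (L v)) ≤ e → Assignment A L s ⊎ Violator A L s
  go e L bound with any? (λ v → any? λ x → any? λ y →
    (A v Bool.≟ true) ×-dec (L v x Bool.≟ true) ×-dec (L v y Bool.≟ true) ×-dec ¬? (x ≟ᶠ y))
  ... | no ¬two = hall-one-colour one
    where
    one : ∀ {v x y} → v ∈ A → x ∈ L v → y ∈ L v → x ≡ y
    one {v} {x} {y} p a b with x ≟ᶠ y
    ... | yes eq = eq
    ... | no  ne = contradiction (v , x , y , p , a , b , ne) ¬two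
  ... | yes (v , x , y , p , a , b , x≢y) = rec e bound
    where
    smaller : ∀ {z} → z ∈ L v → sum (λ u → # (delete L v z u)) < sum (λ u → # (L u))
    smaller q = sum-mono-< (λ u → #-mono delete⁻) v (⊂⇒#< delete⁻ q ∉-delete)
    rec : ∀ e → sum (λ v → # (L v)) ≤ e → Assignment A L s ⊎ Violator A L s
    rec zero    le = contradiction (≤-trans (smaller a) le) λ ()
    rec (suc e) le with go e (delete L v x) (s≤s⁻¹ (≤-trans (smaller a) le))
                      | go e (delete L v y) (s≤s⁻¹ (≤-trans (smaller b) le))
    ... | inj₁ asg | _        = inj₁ (weaken-assignment {A = A} {L′ = delete L v x} (λ _ _ → delete⁻) asg)
    ... | inj₂ _   | inj₁ asg = inj₁ (weaken-assignment {A = A} {L′ = delete L v y} (λ _ _ → delete⁻) asg)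
    ... | inj₂ V₁  | inj₂ V₂  = inj₂ (uncross a b x≢y V₁ V₂)

-- Counting inequalities: p, a and C stand for the sizes of A ∩ W, A and N L A, and t for the
-- number of vertices of A ∩ W whose lists contain the most frequent colour.
-- Both are proved by contradiction: with s and p expressed through the (nonnegative) gaps
-- d, e, f, g in the hypotheses, slack is the expansion of the difference of the two sides.

private
  t+d≤s : ∀ s t d → suc (t + s) + d ≤ suc (2 * s) → t + d ≤ s
  t+d≤s s t d le = +-cancelˡ-≤ (suc s) _ _
    (≤-trans (≤-reflexive (rearrange s t d)) (≤-trans le (≤-reflexive (double s))))
    where
    rearrange : ∀ s t d → suc s + (t + d) ≡ suc (t + s) + d
    rearrange = solve-∀
    double : ∀ s → suc (2 * s) ≡ suc s + s
    double = solve-∀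

-- Bounds the vertices of `A ∩ W` whose lists lack the most frequent colour. Multiplying the count
-- by the capacity and inserting the upper bound on `a` eliminates `C`.
missed-vertices-bound : ∀ s q p t a C → p * suc q ≤ C * t → C * suc s < a →
                        a ≤ p + q * suc (suc s) → p ≤ suc (2 * suc s) → p ≤ t + suc s
missed-vertices-bound s′ q p t a C count C< a≤ p≤ with p ≤? t + suc s′
... | yes le = le
... | no ¬le with d , refl ← m≤n⇒∃[o]m+o≡n (≰⇒> ¬le)
  with e , eq ← m≤n⇒∃[o]m+o≡n {t + d} {suc s′} (t+d≤s (suc s′) t d p≤)
  = contradiction impossible (<⇒≱ ≤-refl)
  where
  open ≤-Reasoning
  s = suc s′
  expand : ∀ t d e q → let s = t + d + e ; p = suc (t + s) + d in
           (p + q * suc s) * t + (q * (s * s + s * d + d + e) + (2 * t + 2 * d + e) * (d + e)) + s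
           ≡ p * suc q * s + t
  expand = solve-∀
  P = suc (t + s) + d
  slack = q * (s * s + s * d + d + e) + (2 * t + 2 * d + e) * (d + e)
  identity : (P + q * suc s) * t + slack + s ≡ P * suc q * s + t
  identity = subst (λ s → let p = suc (t + s) + d in
    (p + q * suc s) * t + (q * (s * s + s * d + d + e) + (2 * t + 2 * d + e) * (d + e)) + s ≡ p * suc q * s + t)
    eq (expand t d e q)
  regroup : ∀ C t s → C * t * s + t ≡ suc (C * s) * t
  regroup = solve-∀
  impossible : suc ((P + q * suc s) * t) ≤ (P + q * suc s) * t
  impossible = begin
    suc ((P + q * suc s) * t)               ≤⟨ s≤s (m≤m+n _ slack) ⟩
    -- The strictness comes from the term `s`, which is positive because `s = suc s′`.
    suc ((P + q * suc s) * t + slack)       ≤⟨ m≤m+n _ s′ ⟩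
    suc ((P + q * suc s) * t + slack) + s′  ≡⟨ +-suc _ s′ ⟨
    (P + q * suc s) * t + slack + s         ≡⟨ identity ⟩
    P * suc q * s + t                       ≤⟨ +-monoˡ-≤ t (*-monoˡ-≤ s count) ⟩
    C * t * s + t                           ≡⟨ regroup C t s ⟩
    suc (C * s) * t                         ≤⟨ *-monoˡ-≤ t (≤-trans C< a≤) ⟩
    (P + q * suc s) * t                     ∎

private
  p-large : ∀ s q p t e → suc (suc s * suc (suc q) + e + t) ≤ p + suc q * suc s + s → t + e + 2 ≤ p
  p-large s q p t e le = +-cancelʳ-≤ (suc q * suc s + s) _ _ (begin
    t + e + 2 + (suc q * suc s + s)    ≡⟨ rearrange s q t e ⟩
    suc (suc s * suc (suc q) + e + t)  ≤⟨ le ⟩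
    p + suc q * suc s + s              ≡⟨ +-assoc p (suc q * suc s) s ⟩
    p + (suc q * suc s + s)            ∎)
    where
    open ≤-Reasoning
    rearrange : ∀ s q t e → t + e + 2 + (suc q * suc s + s) ≡ suc (suc s * suc (suc q) + e + t)
    rearrange = solve-∀

  shift : ∀ t e f → suc (suc (t + e + f)) ≡ t + e + 2 + f
  shift = solve-∀

-- Serves the case that a set to be checked for Hall's condition contains a whole part. There is
-- then at least one part, so `suc q` is the number of parts and `suc (suc q)` the length of the
-- lists.
full-part-bound : ∀ s q p t a C → p * suc (suc q) ≤ C * t → a ≤ p + suc q * suc s →
                  p ≤ suc (2 * s) → suc s * suc (suc q) ≤ C * s → a + s ≤ C * s + t
full-part-bound s q p t a C count a≤ p≤ full with a + s ≤? C * s + t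
... | yes le = le
... | no ¬le with e , Cs≡ ← m≤n⇒∃[o]m+o≡n full
  with f , refl ← m≤n⇒∃[o]m+o≡n {t + e + 2} {p} (p-large s q p t e (≤-trans
         (≤-trans (≤-reflexive (cong (λ z → suc (z + t)) Cs≡)) (≰⇒> ¬le)) (+-monoˡ-≤ s a≤)))
  with g , eq ← m≤n⇒∃[o]m+o≡n {suc (t + e + f)} {2 * s} (s≤s⁻¹ (≤-trans (≤-reflexive (shift t e f)) p≤))
  = contradiction impossible (<⇒≱ ≤-refl)
  where
  open ≤-Reasoning
  P = t + e + 2 + f
  Q = suc (suc q)
  slack : ℕ → ℕ
  slack S = q * (S * (e + f) + 2 * (e + f + g)) + 2 * S * f + 4 * (e + f + g) + 2 * e * (suc (e + f + g)) + 2 * q + 3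
  expand : ∀ q t e f g → let S = suc (t + e + f) + g ; Q = suc (suc q) in
           suc ((S * Q + 2 * Q + 2 * e) * t +
             (q * (S * (e + f) + 2 * (e + f + g)) + 2 * S * f + 4 * (e + f + g) + 2 * e * (suc (e + f + g)) + 2 * q + 3))
           ≡ S * ((t + e + 2 + f) * Q)
  expand = solve-∀
  -- All terms are doubled because the gap `g` expresses `2 * s` rather than `s`.
  identity : suc ((2 * s * Q + 2 * Q + 2 * e) * t + slack (2 * s)) ≡ 2 * s * (P * Q)
  identity = subst (λ S → suc ((S * Q + 2 * Q + 2 * e) * t + slack S) ≡ S * (P * Q)) eq (expand q t e f g)
  swap : ∀ s x → 2 * s * x ≡ 2 * (x * s)
  swap = solve-∀
  swap′ : ∀ s C t → 2 * (C * t * s) ≡ 2 * (C * s) * t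
  swap′ = solve-∀
  double : ∀ s Q e → 2 * (suc s * Q + e) ≡ 2 * s * Q + 2 * Q + 2 * e
  double = solve-∀
  impossible : suc ((2 * s * Q + 2 * Q + 2 * e) * t) ≤ (2 * s * Q + 2 * Q + 2 * e) * t
  impossible = begin
    suc ((2 * s * Q + 2 * Q + 2 * e) * t)                  ≤⟨ s≤s (m≤m+n _ (slack (2 * s))) ⟩
    suc ((2 * s * Q + 2 * Q + 2 * e) * t + slack (2 * s))  ≡⟨ identity ⟩
    2 * s * (P * Q)                                        ≡⟨ swap s (P * Q) ⟩
    2 * (P * Q * s)                                        ≤⟨ *-monoʳ-≤ 2 (*-monoˡ-≤ s count) ⟩
    2 * (C * t * s)                                        ≡⟨ swap′ s C t ⟩
    2 * (C * s) * t                                        ≡⟨ cong (λ z → 2 * z * t) Cs≡ ⟨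
    2 * (suc s * Q + e) * t                                ≡⟨ cong (_* t) (double s Q e) ⟩
    (2 * s * Q + 2 * Q + 2 * e) * t                        ∎

-- Colourings whose classes are small or lie inside a part

module _ (s : ℕ) {n : ℕ} (W : FSet n) where

  Tame : ∀ {q} → (Fin q → FSet n) → FSet n → Set
  Tame P X = # X ≤ s ⊎ X ⊆ W ⊎ ∃ λ j → X ⊆ P j

  Tame-⊆ : ∀ {q} {P : Fin q → FSet n} {X Y} → Y ⊆ X → Tame P X → Tame P Y
  Tame-⊆ Y⊆X (inj₁ le)             = inj₁ (≤-trans (#-mono Y⊆X) le)
  Tame-⊆ Y⊆X (inj₂ (inj₁ X⊆W))     = inj₂ (inj₁ (λ p → X⊆W (Y⊆X p)))
  Tame-⊆ Y⊆X (inj₂ (inj₂ (j , i))) = inj₂ (inj₂ (j , λ p → i (Y⊆X p)))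

  record Colouring {q m} (P : Fin q → FSet n) (A : FSet n) (L : Fin n → FSet (suc m)) : Set where
    constructor mkColouring
    field
      colour     : Fin n → Fin (suc m)
      allowed    : ∀ {v} → v ∈ A → colour v ∈ L v
      class-tame : ∀ c → Tame P (A ∩ fibre colour c)

  colouring-⊆ : ∀ {q m} {P : Fin q → FSet n} {A A′} {L L′ : Fin n → FSet (suc m)} → A′ ⊆ A →
                (∀ v c → v ∈ A′ → c ∈ L v → c ∈ L′ v) → Colouring P A L → Colouring P A′ L′
  colouring-⊆ {A′ = A′} A′⊆A L⊆L′ (mkColouring f f∈ tame) =
    mkColouring f (λ p → L⊆L′ _ _ p (f∈ (A′⊆A p))) λ c →
      Tame-⊆ (λ e → let a , b = ∩⁻ {A = A′} {B = fibre f c} e in ∩⁺ (A′⊆A a) b) (tame c)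

  assignment⇒colouring : ∀ {q m} {P : Fin q → FSet n} {A} {L : Fin n → FSet (suc m)} →
                         Assignment A L s → Colouring P A L
  assignment⇒colouring (f , f∈ , small) = mkColouring f f∈ λ c → inj₁ (small c)

  constant-colouring : ∀ {q m} {P : Fin q → FSet n} {A} {L : Fin n → FSet (suc m)} {c} →
                       (∀ {X} → X ⊆ A → Tame P X) → (∀ {v} → v ∈ A → c ∈ L v) → Colouring P A L
  constant-colouring {c = c} tame c∈ = mkColouring (λ _ → c) c∈ λ d → tame (λ p → proj₁ (∩⁻ p))

  -- The colours in D are used on B only, so no colour class of the union is new.
  glue : ∀ {q m} {P : Fin q → FSet n} {A} {L : Fin n → FSet (suc m)} B D →
         Colouring P (A ∩ B) (λ v → L v ∩ D) → Colouring P (A ─ B) (λ v → L v ─ D) → Colouring P A L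
  glue {m = m} {P = P} {A} {L} B D (mkColouring f f∈ tame-f) (mkColouring g g∈ tame-g) = mkColouring h h∈ tame
    where
    h : Fin n → Fin (suc m)
    h v = if B v then f v else g v
    h-in : ∀ {v} → v ∈ B → h v ≡ f v
    h-in e rewrite e = refl
    h-out : ∀ {v} → v ∉ B → h v ≡ g v
    h-out e rewrite e = refl
    h∈ : ∀ {v} → v ∈ A → h v ∈ L v
    h∈ {v} p with ∈-or-∉ B v
    ... | inj₁ b = subst (_∈ L v) (sym (h-in b)) (proj₁ (∩⁻ (f∈ (∩⁺ p b))))
    ... | inj₂ b = subst (_∈ L v) (sym (h-out b)) (proj₁ (─⁻ (g∈ (─⁺ p b))))
    tame : ∀ c → Tame P (A ∩ fibre h c)
    tame c with ∈-or-∉ D c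
    ... | inj₁ c∈D = Tame-⊆ class⊆ (tame-f c)
      where
      class⊆ : (A ∩ fibre h c) ⊆ ((A ∩ B) ∩ fibre f c)
      class⊆ {v} e with a , b ← ∩⁻ {A = A} {B = fibre h c} e with ∈-or-∉ B v
      ... | inj₁ v∈B = ∩⁺ (∩⁺ a v∈B) (subst (_∈ ⁅ c ⁆) (h-in v∈B) b)
      ... | inj₂ v∉B with _ , g∉D ← ─⁻ (g∈ (─⁺ a v∉B)) =
        ∈-∉ {A = D} c∈D (subst (_∉ D) (trans (sym (h-out v∉B)) (∈⁅⁆⁻ b)) g∉D)
    ... | inj₂ c∉D = Tame-⊆ class⊆ (tame-g c)
      where
      class⊆ : (A ∩ fibre h c) ⊆ ((A ─ B) ∩ fibre g c)
      class⊆ {v} e with a , b ← ∩⁻ {A = A} {B = fibre h c} e with ∈-or-∉ B v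
      ... | inj₂ v∉B = ∩⁺ (─⁺ a v∉B) (subst (_∈ ⁅ c ⁆) (h-out v∉B) b)
      ... | inj₁ v∈B with _ , f∈D ← ∩⁻ (f∈ (∩⁺ a v∈B)) =
        ∈-∉ {A = D} (subst (_∈ D) (trans (sym (h-in v∈B)) (∈⁅⁆⁻ b)) f∈D) c∉D

-- Finite choice

argmax : (g : Fin (suc m) → ℕ) → ∃ λ c → ∀ d → g d ≤ g c
argmax {zero}  g = zero , λ { zero → ≤-refl }
argmax {suc m} g with c , max ← argmax (g ∘ suc) with ≤-total (g zero) (g (suc c))
... | inj₁ le = suc c , λ { zero → le ; (suc d) → max d }
... | inj₂ le = zero  , λ { zero → ≤-refl ; (suc d) → ≤-trans (max d) le }

-- Used twice in a row, for parts and for colours, to find either a colour common to a part or, for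
-- each part and colour, a vertex that lacks the colour.
∃-or-∀ : ∀ {m} {X Y : Fin m → Set} → (∀ i → X i ⊎ Y i) → ∃ X ⊎ (∀ i → Y i)
∃-or-∀ {zero}  h = inj₂ λ ()
∃-or-∀ {suc m} h with h zero | ∃-or-∀ (h ∘ suc)
... | inj₁ x | _            = inj₁ (zero , x)
... | inj₂ _ | inj₁ (i , x) = inj₁ (suc i , x)
... | inj₂ y | inj₂ ys      = inj₂ λ { zero → y ; (suc i) → ys i }

#-─⁅⁆ : (A : FSet n) (x : Fin n) → # A ≤ suc (# (A ─ ⁅ x ⁆))
#-─⁅⁆ A x = ≤-trans (#-─ A ⁅ x ⁆)
  (+-monoˡ-≤ _ (≤-trans (#-mono (λ e → proj₂ (∩⁻ e))) (≤-reflexive (#-⁅⁆ x))))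

-- Induction on the number of parts and on the size of the vertex set

module Induction (s′ : ℕ) {n m : ℕ} (W : FSet n) (W≤ : # W ≤ suc (2 * suc s′)) where

  s = suc s′

  record Instance {q : ℕ} (P : Fin q → FSet n) (A : FSet n) (L : Fin n → FSet (suc m)) : Set where
    field
      P≤    : ∀ j → # (P j) ≤ suc s
      cover : ∀ {v} → v ∈ A → v ∈ W ⊎ ∃ λ j → v ∈ P j
      big   : ∀ {v} → v ∈ A → suc q ≤ # (L v)

  open Instance

  NoCommonColour : ∀ {q} → (Fin q → FSet n) → FSet n → (Fin n → FSet (suc m)) → Set
  NoCommonColour P A L = ∀ j d → ∃ λ v → v ∈ A ∩ P j × d ∉ L v

  -- The class of `c` is `A ∩ P j`, which is tame. Forbidding `c` elsewhere costs each list at most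
  -- one colour, and one part disappears as well, so the hypothesis on list sizes survives.
  drop-part : ∀ {q} {P : Fin (suc q) → FSet n} {A L} → Instance P A L →
              (∀ {P A L} → Instance {q} P A L → Colouring s W P A L) →
              ∀ j c → (∀ {v} → v ∈ A ∩ P j → c ∈ L v) → Colouring s W P A L
  drop-part {q} {P} {A} {L} inst rec j c common = glue s W (P j) ⁅ c ⁆
    (constant-colouring s W (λ X⊆ → inj₂ (inj₂ (j , λ p → proj₂ (∩⁻ (X⊆ p)))))
      (λ p → ∩⁺ (common p) (self∈⁅⁆ c)))
    (unpunch (rec {P ∘ punchIn j} record
      { P≤    = λ i → P≤ inst (punchIn j i)
      ; cover = cov
      ; big   = λ {v} p → s≤s⁻¹ (≤-trans (big inst (proj₁ (─⁻ p))) (#-─⁅⁆ (L v) c))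
      }))
    where
    cov : ∀ {v} → v ∈ A ─ P j → v ∈ W ⊎ ∃ λ i → v ∈ P (punchIn j i)
    cov {v} p with a , b ← ─⁻ p with cover inst a
    ... | inj₁ w = inj₁ w
    ... | inj₂ (i , e) with j ≟ᶠ i
    ...   | yes refl = ∈-∉ {A = P j} e b
    ...   | no  j≢i  = inj₂ (punchOut j≢i , subst (λ i → v ∈ P i) (sym (punchIn-punchOut j≢i)) e)
    unpunch : ∀ {A L} → Colouring s W (P ∘ punchIn j) A L → Colouring s W P A L
    unpunch (mkColouring f f∈ tame) = mkColouring f f∈ λ c → widen (tame c)
      where
      widen : ∀ {X} → Tame s W (P ∘ punchIn j) X → Tame s W P X
      widen (inj₁ le)             = inj₁ le
      widen (inj₂ (inj₁ X⊆W))     = inj₂ (inj₁ X⊆W)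
      widen (inj₂ (inj₂ (i , e))) = inj₂ (inj₂ (punchIn j i , e))

  -- The case of failure on `A` itself. Since `A` sees few colours, the colour `c` must be frequent
  -- on `A ∩ W`.
  module Violated {q} {P : Fin q → FSet n} {A L} (inst : Instance P A L)
                  (none : NoCommonColour P A L) (few : # (N L A) * s < # A) where

    open ≤-Reasoning

    inW∩ : Fin (suc m) → FSet n
    inW∩ d = (A ∩ W) ∩ λ v → L v d

    c : Fin (suc m)
    c = proj₁ (argmax (λ d → # (inW∩ d)))

    p τ : ℕ
    p = # (A ∩ W)
    τ = # (inW∩ c)

    Wc : FSet n
    Wc = W ∩ λ v → L v c

    L′ : Fin n → FSet (suc m)
    L′ v = L v ─ ⁅ c ⁆

    p≤ : p ≤ suc (2 * s)
    p≤ = ≤-trans (#-mono (λ e → proj₂ (∩⁻ e))) W≤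

    count : p * suc q ≤ # (N L A) * τ
    count = double-count L (A ∩ W) (N L A) (λ e → big inst (proj₁ (∩⁻ e)))
      (λ e l → N⁺ (proj₁ (∩⁻ e)) l) (proj₂ (argmax (λ d → # (inW∩ d))))

    parts≤ : ∀ X k → X ⊆ A → (∀ j → # (X ∩ P j) ≤ k) → # X ≤ # (X ∩ W) + q * k
    parts≤ X k X⊆A small = begin
      # X                                         ≤⟨ #-cover P W X (λ e → cover inst (X⊆A e)) ⟩
      # (X ∩ W) + sum (λ j → # (X ∩ P j))         ≤⟨ +-monoʳ-≤ (# (X ∩ W)) (sum-mono small) ⟩
      # (X ∩ W) + sum {q} (λ _ → k)               ≡⟨ cong (# (X ∩ W) +_) (sum-const q k) ⟩
      # (X ∩ W) + q * k                           ∎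

    A≤ : # A ≤ p + q * suc s
    A≤ = parts≤ A (suc s) (λ e → e) (λ j → ≤-trans (#-mono (λ e → proj₂ (∩⁻ e))) (P≤ inst j))

    p≤τ+s : p ≤ τ + s
    p≤τ+s = missed-vertices-bound s′ q p τ (# A) (# (N L A)) count few A≤ p≤

    module _ {X : FSet n} (X⊆ : X ⊆ A ─ Wc) where

      X⊆A : X ⊆ A
      X⊆A e = proj₁ (─⁻ (X⊆ e))

      c∉L : ∀ {v} → v ∈ X → v ∈ W → c ∉ L v
      c∉L {v} x w with ∈-or-∉ (L v) c
      ... | inj₂ c∉ = c∉
      ... | inj₁ c∈ = ∈-∉ {A = Wc} (∩⁺ w c∈) (proj₂ (─⁻ (X⊆ x)))

      -- `X` avoids the `τ` vertices of `A ∩ W` that receive `c`, and at most `s` others exist.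
      X∩W≤s : # (X ∩ W) ≤ s
      X∩W≤s = +-cancelʳ-≤ τ _ _ (begin
        # (X ∩ W) + τ  ≤⟨ #-superadditive (λ e → let x , w = ∩⁻ e in ∩⁺ (X⊆A x) w) (λ e → proj₁ (∩⁻ e)) disjoint ⟩
        p              ≤⟨ p≤τ+s ⟩
        τ + s          ≡⟨ +-comm τ s ⟩
        s + τ          ∎)
        where
        disjoint : ∀ {v} → v ∈ X ∩ W → v ∉ inW∩ c
        disjoint {v} e with ∈-or-∉ (inW∩ c) v
        ... | inj₂ no∈ = no∈
        ... | inj₁ yes∈ with x , w ← ∩⁻ e | _ , l ← ∩⁻ {A = A ∩ W} {B = λ v → L v c} yes∈ = ∈-∉ {A = L v} l (c∉L x w)

      -- The parts contribute at most `q * s` vertices. If `X` misses `W`, the `q` colours left to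
      -- any vertex suffice. If `X` meets `W` in `v`, the list of `v` lacks `c` and keeps `suc q`
      -- colours, which also pays for the at most `s` vertices in `W`.
      scattered : (∀ j → # (X ∩ P j) ≤ s) → # X ≤ # (N L′ X) * s
      scattered small with ∈-nonempty (X ∩ W) | ∈-nonempty X
        where
        ∈-nonempty : ∀ (Y : FSet n) → (∀ {v} → ¬ v ∈ Y) ⊎ ∃ λ v → v ∈ Y
        ∈-nonempty Y with ⊆-or-witness Y ∅
        ... | inj₁ Y⊆∅         = inj₁ λ e → ∅⁻ (Y⊆∅ e)
        ... | inj₂ (v , e , _) = inj₂ (v , e)
      ... | _ | inj₁ empty = ≤-trans (≤-reflexive (empty⇒#≡0 empty)) z≤n
      ... | inj₁ empty | inj₂ (v , x) = begin
        # X                ≤⟨ parts≤ X s X⊆A small ⟩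
        # (X ∩ W) + q * s  ≡⟨ cong (_+ q * s) (empty⇒#≡0 empty) ⟩
        q * s              ≤⟨ *-monoˡ-≤ s (s≤s⁻¹ (≤-trans (big inst (X⊆A x)) (#-─⁅⁆ (L v) c))) ⟩
        # (L′ v) * s       ≤⟨ *-monoˡ-≤ s (#-mono {B = N L′ X} (λ e → N⁺ x e)) ⟩
        # (N L′ X) * s     ∎
      ... | inj₂ (v , e) | _ with x , w ← ∩⁻ e = begin
        # X                ≤⟨ parts≤ X s X⊆A small ⟩
        # (X ∩ W) + q * s  ≤⟨ +-monoˡ-≤ (q * s) X∩W≤s ⟩
        suc q * s          ≤⟨ *-monoˡ-≤ s (big inst (X⊆A x)) ⟩
        # (L v) * s        ≤⟨ *-monoˡ-≤ s (#-mono {B = N L′ X} (λ l → N⁺ x (─⁺ l (not-c l)))) ⟩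
        # (N L′ X) * s     ∎
        where
        not-c : ∀ {d} → d ∈ L v → d ∉ ⁅ c ⁆
        not-c {d} l with ∈-or-∉ ⁅ c ⁆ d
        ... | inj₂ d∉ = d∉
        ... | inj₁ d∈ = ∈-∉ {A = L v} (subst (_∈ L v) (∈⁅⁆⁻ d∈) l) (c∉L x w)

      -- P j already sees all colours: every colour is missing from some list on P j, hence
      -- (s + 1) (q + 1) ≤ s |N L (P j)|, whereas s |N L A| < |A| ≤ 2 s + 1 + q (s + 1).
      contains-part : ∀ j → s < # (X ∩ P j) → # X ≤ # (N L′ X) * s
      contains-part j s< = +-cancelʳ-≤ (τ + s) _ _ (begin
        # X + (τ + s)                     ≡⟨ +-assoc (# X) τ s ⟨
        # X + τ + s                       ≤⟨ +-monoˡ-≤ s (#-superadditive X⊆A (λ e → proj₁ (∩⁻ (proj₁ (∩⁻ {B = λ v → L v c} e)))) disjoint) ⟩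
        # A + s                           ≤⟨ bound q refl j ⟩
        # (N L A) * s + τ                 ≤⟨ +-monoˡ-≤ τ (*-monoˡ-≤ s (≤-trans C≤Y (≤-trans (#-mono (N-mono L Pj⊆X)) NX≤))) ⟩
        suc (# (N L′ X)) * s + τ          ≡⟨ rearrange (# (N L′ X) * s) s τ ⟩
        # (N L′ X) * s + (τ + s)          ∎)
        where
        rearrange : ∀ a s t → s + a + t ≡ a + (t + s)
        rearrange = solve-∀
        disjoint : ∀ {v} → v ∈ X → v ∉ inW∩ c
        disjoint {v} x with ∈-or-∉ (inW∩ c) v
        ... | inj₂ no∈ = no∈
        ... | inj₁ yes∈ with aw , l ← ∩⁻ {A = A ∩ W} {B = λ v → L v c} yes∈ =
          ∈-∉ {A = L v} l (c∉L x (proj₂ (∩⁻ aw)))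
        -- `P j` has at most `s + 1` elements and more than `s` of them lie in `X`.
        Pj⊆X : P j ⊆ X
        Pj⊆X e = proj₁ (∩⁻ (#≤⇒⊇ (λ e → proj₂ (∩⁻ {A = X} e)) (≤-trans (P≤ inst j) s<) e))
        Y = N L (P j)
        Y-large : suc s * suc q ≤ # Y * s
        Y-large = ≤-trans (*-monoˡ-≤ (suc q) (≤-trans s< (#-mono (λ e → proj₂ (∩⁻ e)))))
          (double-count L (P j) Y (λ e → big inst (X⊆A (Pj⊆X e))) N⁺ missing)
          where
          missing : ∀ d → # (P j ∩ λ v → L v d) ≤ s
          missing d with v , e , d∉ ← none j d = s≤s⁻¹ (≤-trans
            (⊂⇒#< {v = v} (λ e → proj₁ (∩⁻ {B = λ v → L v d} e)) (proj₂ (∩⁻ e)) v∉) (P≤ inst j))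
            where
            v∉ : v ∉ (P j ∩ λ v → L v d)
            v∉ with ∈-or-∉ (P j ∩ λ v → L v d) v
            ... | inj₂ no∈ = no∈
            ... | inj₁ yes∈ = ∈-∉ {A = L v} (proj₂ (∩⁻ {A = P j} {B = λ v → L v d} yes∈)) d∉
        C≤Y : # (N L A) ≤ # Y
        C≤Y = ≮⇒≥ λ lt → contradiction (≤-refl {p + q * suc s}) (<⇒≱ (begin-strict
          p + q * suc s                      ≤⟨ +-monoˡ-≤ (q * suc s) p≤ ⟩
          suc (2 * s) + q * suc s            ≡⟨ regroup s q ⟩
          s + suc s * suc q                  ≤⟨ +-monoʳ-≤ s Y-large ⟩
          suc (# Y) * s                      ≤⟨ *-monoˡ-≤ s lt ⟩
          # (N L A) * s                      <⟨ few ⟩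
          # A                                ≤⟨ A≤ ⟩
          p + q * suc s                      ∎))
          where
          regroup : ∀ s q → suc (2 * s) + q * suc s ≡ s + suc s * suc q
          regroup = solve-∀
        NX≤ : # (N L X) ≤ suc (# (N L′ X))
        NX≤ = ≤-trans (#-─⁅⁆ (N L X) c) (s≤s (#-mono λ e →
          let e′ , d∉ = ─⁻ e ; v , x , l = N⁻ e′ in N⁺ x (─⁺ l d∉)))
        -- The index of the part shows that `q` is a successor, as `full-part-bound` requires.
        bound : ∀ q′ → q′ ≡ q → Fin q′ → # A + s ≤ # (N L A) * s + τ
        bound (suc q′) refl _ = full-part-bound s q′ p τ (# A) (# (N L A)) count A≤ p≤
          (≤-trans Y-large (*-monoˡ-≤ s (#-mono (N-mono L (λ e → X⊆A (Pj⊆X e))))))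

      hall-condition : # X ≤ # (N L′ X) * s
      hall-condition with any? (λ j → s <? # (X ∩ P j))
      ... | yes (j , s<) = contains-part j s<
      ... | no ¬full     = scattered (λ j → ≮⇒≥ λ lt → ¬full (j , lt))

    colouring : Colouring s W P A L
    colouring with hall (A ─ Wc) L′ s
    ... | inj₂ (X , X⊆ , bad) = contradiction (hall-condition X⊆) (<⇒≱ bad)
    ... | inj₁ asg = glue s W Wc ⁅ c ⁆
      (constant-colouring s W
        (λ X⊆ → inj₂ (inj₁ λ e → proj₁ (∩⁻ {B = λ v → L v c} (proj₂ (∩⁻ {A = A} (X⊆ e))))))
        (λ e → ∩⁺ (proj₂ (∩⁻ {A = W} {B = λ v → L v c} (proj₂ (∩⁻ {A = A} e)))) (self∈⁅⁆ c)))
      (assignment⇒colouring s W asg)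

  -- If the vertices outside T violate Hall's condition for the colours outside N L T at X,
  -- then T ∪ X is a larger violator than T.
  enlarge : ∀ {q} {P : Fin q → FSet n} {A L} → Instance P A L → NoCommonColour P A L →
            (∀ T → T ⊆ A → # T < # A → Colouring s W P T L) →
            ∀ fuel T → # A ≤ # T + fuel → T ⊆ A → # (N L T) * s < # T → Colouring s W P A L
  enlarge {P = P} {A} {L} inst none rec fuel T enough T⊆A bad with ⊆-or-witness A T
  -- `T` has grown to all of `A`.
  ... | inj₁ A⊆T = Violated.colouring inst none
    (≤-trans (s≤s (*-monoˡ-≤ s (#-mono (N-mono L A⊆T)))) (≤-trans bad (#-mono T⊆A)))
  ... | inj₂ (v , v∈A , v∉T) with hall (A ─ T) (λ v → L v ─ N L T) s
  -- The coloring of `T` uses only `N L T` and the rest avoids it, so no class gains vertices.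
  ...   | inj₁ asg = glue s W T (N L T)
    (colouring-⊆ s W (λ e → proj₂ (∩⁻ e)) (λ u c e l → ∩⁺ l (N⁺ (proj₂ (∩⁻ e)) l))
      (rec T T⊆A (⊂⇒#< T⊆A v∈A v∉T)))
    (assignment⇒colouring s W asg)
  ...   | inj₂ (X , X⊆ , bad′) = continue fuel enough
    where
    open ≤-Reasoning
    T+X≤ : # T + # X ≤ # (T ∪ X)
    T+X≤ = #-superadditive ∪⁺ˡ ∪⁺ʳ disjoint
      where
      disjoint : ∀ {u} → u ∈ T → u ∉ X
      disjoint {u} e with ∈-or-∉ X u
      ... | inj₂ u∉ = u∉
      ... | inj₁ u∈ = ∈-∉ {A = T} e (proj₂ (─⁻ (X⊆ u∈)))
    T∪X⊆A : T ∪ X ⊆ A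
    T∪X⊆A e with ∪⁻ e
    ... | inj₁ e′ = T⊆A e′
    ... | inj₂ e′ = proj₁ (─⁻ (X⊆ e′))
    NX = N (λ v → L v ─ N L T) X
    N∪ : ∀ {c} → c ∈ N L (T ∪ X) → c ∈ N L T ⊎ c ∈ NX
    N∪ {c} e with u , e′ , l ← N⁻ e with ∪⁻ e′ | ∈-or-∉ (N L T) c
    ... | inj₁ u∈T | _      = inj₁ (N⁺ u∈T l)
    ... | inj₂ u∈X | inj₁ y = inj₁ y
    ... | inj₂ u∈X | inj₂ y = inj₂ (N⁺ u∈X (─⁺ l y))
    bad∪ : # (N L (T ∪ X)) * s < # (T ∪ X)
    bad∪ = begin-strict
      # (N L (T ∪ X)) * s        ≤⟨ *-monoˡ-≤ s (#-subadditive N∪) ⟩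
      (# (N L T) + # NX) * s     ≡⟨ *-distribʳ-+ s (# (N L T)) (# NX) ⟩
      # (N L T) * s + # NX * s   <⟨ +-mono-< bad bad′ ⟩
      # T + # X                  ≤⟨ T+X≤ ⟩
      # (T ∪ X)                  ∎
    continue : ∀ fuel → # A ≤ # T + fuel → Colouring s W P A L
    continue zero enough = contradiction (≤-trans enough (≤-reflexive (+-identityʳ (# T))))
      (<⇒≱ (⊂⇒#< T⊆A v∈A v∉T))
    continue (suc fuel) enough = enlarge inst none rec fuel (T ∪ X) (begin
      # A                 ≤⟨ enough ⟩
      # T + suc fuel      ≡⟨ +-suc (# T) fuel ⟩
      suc (# T) + fuel    ≡⟨ cong (_+ fuel) (+-comm 1 (# T)) ⟩
      -- A violator is nonempty, so `T ∪ X` is strictly larger than `T` and one unit of fuel pays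
      -- for the step.
      # T + 1 + fuel      ≤⟨ +-monoˡ-≤ fuel (+-monoʳ-≤ (# T) (≤-trans (s≤s z≤n) bad′)) ⟩
      # T + # X + fuel    ≤⟨ +-monoˡ-≤ fuel T+X≤ ⟩
      # (T ∪ X) + fuel    ∎) T∪X⊆A bad∪

  restrict : ∀ {q} {P : Fin q → FSet n} {A T L} → T ⊆ A → Instance P A L → Instance P T L
  restrict T⊆A inst = record
    { P≤ = P≤ inst ; cover = λ e → cover inst (T⊆A e) ; big = λ e → big inst (T⊆A e) }

  -- Induction on the size of `A` with parts and lists fixed. A part with a common colour is left to
  -- `common`, which the outer induction on `q` supplies through `drop-part`.
  colouring-by-size : ∀ {q} {P : Fin q → FSet n} {L} →
    (∀ {A} → Instance P A L → ∀ j c → (∀ {v} → v ∈ A ∩ P j → c ∈ L v) → Colouring s W P A L) →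
    ∀ a A → # A ≤ a → Instance P A L → Colouring s W P A L
  colouring-by-size {q} {P} {L} common a A A≤a inst
    with ∃-or-∀ (λ j → ∃-or-∀ (λ c → ⊆-or-witness (A ∩ P j) (λ v → L v c)))
  ... | inj₁ (j , c , e) = common inst j c e
  ... | inj₂ none with hall A L s
  ...   | inj₁ asg = assignment⇒colouring s W asg
  ...   | inj₂ (T , T⊆A , bad) = enlarge inst none (smaller a A≤a) (# A) T (m≤n+m (# A) (# T)) T⊆A bad
    where
    smaller : ∀ a → # A ≤ a → ∀ T → T ⊆ A → # T < # A → Colouring s W P T L
    smaller zero    le T T⊆A lt = contradiction (≤-trans lt le) λ ()
    smaller (suc a) le T T⊆A lt = colouring-by-size common a T (s≤s⁻¹ (≤-trans lt le)) (restrict T⊆A inst)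

  colouring : ∀ q {P : Fin q → FSet n} {A L} → Instance P A L → Colouring s W P A L
  colouring zero    {A = A} inst = colouring-by-size (λ _ ()) (# A) A ≤-refl inst
  colouring (suc q) {A = A} inst =
    colouring-by-size (λ inst → drop-part inst (colouring q)) (# A) A ≤-refl inst

-- The parts of a complete multipartite hypergraph

full : FSet n
full _ = true

#-full : # (full {n}) ≡ n
#-full {n} = trans (#≡sum full) (trans (sum-const n 1) (*-identityʳ n))

#-split : ∀ a {b} (A : FSet (a + b)) → # A ≡ # (λ i → A (i ↑ˡ b)) + # (λ j → A (a ↑ʳ j))
#-split a {b} A = trans (#≡sum A) (trans (sum-split a (𝟙 ∘ A))
  (sym (cong₂ _+_ (#≡sum (λ i → A (i ↑ˡ b))) (#≡sum (λ j → A (a ↑ʳ j))))))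
  where
  sum-split : ∀ a {b} (f : Fin (a + b) → ℕ) → sum f ≡ sum (λ i → f (i ↑ˡ b)) + sum (λ j → f (a ↑ʳ j))
  sum-split zero    f = refl
  sum-split (suc a) f = trans (cong (f zero +_) (sum-split a (f ∘ suc))) (sym (+-assoc (f zero) _ _))

opaque

  part : (p : List ℕ) → ℕ → FSet (sumˡ p)
  part p i v = does (partOf p v ≟ i)

  part⁺ : ∀ p {i v} → partOf p v ≡ i → v ∈ part p i
  part⁺ p = dec-true (partOf p _ ≟ _)

  part⁻ : ∀ p {i v} → v ∈ part p i → partOf p v ≡ i
  part⁻ p = does-true (partOf p _ ≟ _)

partOf-↑ˡ : ∀ a ps i → partOf (a ∷ ps) (i ↑ˡ sumˡ ps) ≡ 0
partOf-↑ˡ a ps i rewrite splitAt-↑ˡ a i (sumˡ ps) = refl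

partOf-↑ʳ : ∀ a ps i → partOf (a ∷ ps) (a ↑ʳ i) ≡ suc (partOf ps i)
partOf-↑ʳ a ps i rewrite splitAt-↑ʳ a (sumˡ ps) i = refl

#-part-zero : ∀ a ps → # (part (a ∷ ps) 0) ≡ a
#-part-zero a ps = begin
  # (part (a ∷ ps) 0)  ≡⟨ trans (#-split a (part (a ∷ ps) 0)) (cong₂ _+_ left right) ⟩
  a + 0                ≡⟨ +-identityʳ a ⟩
  a                    ∎
  where
  open ≡-Reasoning
  left : # (λ i → part (a ∷ ps) 0 (i ↑ˡ sumˡ ps)) ≡ a
  left = trans (≤-antisym (#-mono λ _ → refl) (#-mono λ {i} _ → part⁺ (a ∷ ps) (partOf-↑ˡ a ps i))) #-full
  right : # (λ i → part (a ∷ ps) 0 (a ↑ʳ i)) ≡ 0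
  right = empty⇒#≡0 λ {i} e → contradiction (trans (sym (part⁻ (a ∷ ps) e)) (partOf-↑ʳ a ps i)) λ ()

#-part-suc : ∀ a ps i → # (part (a ∷ ps) (suc i)) ≤ # (part ps i)
#-part-suc a ps i = begin
  # (part (a ∷ ps) (suc i))  ≡⟨ trans (#-split a (part (a ∷ ps) (suc i))) (cong₂ _+_ left refl) ⟩
  _                          ≤⟨ #-mono right ⟩
  # (part ps i)              ∎
  where
  open ≤-Reasoning
  left : # (λ v → part (a ∷ ps) (suc i) (v ↑ˡ sumˡ ps)) ≡ 0
  left = empty⇒#≡0 λ {v} e → contradiction (trans (sym (partOf-↑ˡ a ps v)) (part⁻ (a ∷ ps) e)) λ ()
  right : (λ v → part (a ∷ ps) (suc i) (a ↑ʳ v)) ⊆ part ps i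
  right {v} e = part⁺ ps (suc-injective (trans (sym (partOf-↑ʳ a ps v)) (part⁻ (a ∷ ps) e)))

-- The parts with index `q` or more are empty.
#-part-replicate : ∀ q r i → # (part (replicate q r) i) ≤ r
#-part-replicate zero    r i       = ≤-trans (≤-reflexive (empty⇒#≡0 λ { {()} })) z≤n
#-part-replicate (suc q) r zero    = ≤-reflexive (#-part-zero r (replicate q r))
#-part-replicate (suc q) r (suc i) = ≤-trans (#-part-suc r (replicate q r) i) (#-part-replicate q r i)

partOf< : ∀ p v → partOf p v < length p
partOf< (a ∷ ps) v with splitAt a v
... | inj₁ _ = s≤s z≤n
... | inj₂ w = s≤s (partOf< ps w)

-- Sets of prescribed size

#-lookup : (S : Subset n) → # (lookup S) ≡ ∣ S ∣
#-lookup S = trans (#≡sum (lookup S)) (count S)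
  where
  count : ∀ {n} (S : Subset n) → sum (𝟙 ∘ lookup S) ≡ ∣ S ∣
  count []          = refl
  count (true ∷ S)  = cong suc (count S)
  count (false ∷ S) = count S

insert-⊆ : ∀ {X Y : FSet n} {v} → v ∈ X → Y ⊆ X → ⁅ v ⁆ ∪ Y ⊆ X
insert-⊆ {X = X} v∈ Y⊆X e with ∪⁻ e
... | inj₁ e′ = subst (_∈ X) (sym (∈⁅⁆⁻ e′)) v∈
... | inj₂ e′ = Y⊆X e′

#-insert : ∀ {Y : FSet n} {v} → v ∉ Y → # (⁅ v ⁆ ∪ Y) ≡ suc (# Y)
#-insert {Y = Y} {v} v∉ = ≤-antisym
  (≤-trans (#-subadditive ∪⁻) (≤-reflexive (cong (_+ # Y) (#-⁅⁆ v))))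
  (⊂⇒#< ∪⁺ʳ (∪⁺ˡ (self∈⁅⁆ v)) v∉)

-- Vertices of `X` are added to `Y` one at a time. This extends a pair of vertices to an edge and
-- selects `r` vertices of the large part.
subset-between : ∀ {Y X : FSet n} {r} → Y ⊆ X → # Y ≤ r → r ≤ # X →
                 ∃ λ Z → Y ⊆ Z × Z ⊆ X × # Z ≡ r
subset-between {Y = Y} {X} {r} Y⊆X Y≤r r≤X with d , eq ← m≤n⇒∃[o]m+o≡n Y≤r = grow d Y Y⊆X eq
  where
  grow : ∀ d Y → Y ⊆ X → # Y + d ≡ r → ∃ λ Z → Y ⊆ Z × Z ⊆ X × # Z ≡ r
  grow zero    Y Y⊆X eq = Y , (λ e → e) , Y⊆X , trans (sym (+-identityʳ (# Y))) eq
  grow (suc d) Y Y⊆X eq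
    with v , v∈ , v∉ ← #<⇒witness {A = Y} {B = X} (≤-trans (≤-trans (s≤s (m≤m+n (# Y) d))
                         (≤-reflexive (trans (sym (+-suc (# Y) d)) eq))) r≤X)
    with Z , Y′⊆Z , Z⊆X , #Z ← grow d (⁅ v ⁆ ∪ Y) (insert-⊆ v∈ Y⊆X) (trans (cong (_+ d) (#-insert v∉)) (trans (sym (+-suc (# Y) d)) eq))
    = Z , (λ e → Y′⊆Z (∪⁺ʳ e)) , Z⊆X , #Z

-- Choosability

palette : ∀ m → List ℕ → FSet m
palette m xs c = does (toℕ c ∈? xs)

length≤#-palette : ∀ m {xs} → Unique xs → (∀ {x} → x ∈ˡ xs → x < m) → length xs ≤ # (palette m xs)
length≤#-palette m [] _ = z≤n
length≤#-palette m {x ∷ xs} (x∉xs ∷ unique) bound = begin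
  suc (length xs)              ≤⟨ s≤s (length≤#-palette m unique (λ e → bound (there e))) ⟩
  1 + # (palette m xs)         ≡⟨ cong (_+ # (palette m xs)) (#-⁅⁆ c) ⟨
  # ⁅ c ⁆ + # (palette m xs)   ≤⟨ #-superadditive new old disjoint ⟩
  # (palette m (x ∷ xs))       ∎
  where
  open ≤-Reasoning
  c = fromℕ< (bound (here refl))
  new : ⁅ c ⁆ ⊆ palette m (x ∷ xs)
  new {d} e = dec-true (toℕ d ∈? (x ∷ xs)) (here (trans (cong toℕ (∈⁅⁆⁻ e)) (toℕ-fromℕ< _)))
  old : palette m xs ⊆ palette m (x ∷ xs)
  old {d} e = dec-true (toℕ d ∈? (x ∷ xs)) (there (does-true (toℕ d ∈? xs) e))
  disjoint : ∀ {d} → d ∈ ⁅ c ⁆ → d ∉ palette m xs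
  disjoint {d} e = dec-false (toℕ d ∈? xs) λ d∈ →
    lookupᴬ x∉xs d∈ (sym (trans (cong toℕ (∈⁅⁆⁻ e)) (toℕ-fromℕ< _)))

module _ (s′ q : ℕ) where

  private
    r : ℕ
    parts sizes : List ℕ
    H : Hypergraph
    -- The capacity is `r ∸ 1 = suc s′`, and the lists have `suc q` colours for `q` parts besides
    -- the large one.
    r = suc (suc s′)
    parts = replicate q r
    sizes = (2 * r ∸ 1) ∷ parts
    H = K r (suc q)

    odd : ∀ s′ → suc s′ + (suc (suc s′) + 0) ≡ suc (2 * suc s′)
    odd = solve-∀

  choosable : Choosable H (suc q)
  choosable L isList = (toℕ ∘ f) , (λ v → does-true (_ ∈? L v) (allowed {v} refl)) , proper
    where
    -- No list contains a colour above `M`, so `suc M` colours form a palette.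
    M = max 0 (concat (tabulateˡ L))
    L′ : Fin (order H) → FSet (suc M)
    L′ v = palette (suc M) (L v)
    W = part sizes 0
    P : Fin q → FSet (order H)
    P j = part sizes (suc (toℕ j))
    W≤ : # W ≤ suc (2 * suc s′)
    W≤ = ≤-reflexive (trans (#-part-zero (2 * r ∸ 1) parts) (odd s′))
    open Induction s′ {order H} {M} W W≤
    cover : ∀ {v} → v ∈ full → v ∈ W ⊎ ∃ λ j → v ∈ P j
    cover {v} _ with partOf sizes v in eq | partOf< sizes v
    ... | zero  | _  = inj₁ (part⁺ sizes eq)
    ... | suc i | lt = inj₂ (fromℕ< i< , part⁺ sizes (trans eq (cong suc (sym (toℕ-fromℕ< i<)))))
      where
      i< : i < q
      i< = subst (i <_) (length-replicate q) (s≤s⁻¹ lt)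
    inst : Instance P full L′
    inst = record
      { P≤    = λ j → ≤-trans (#-part-suc (2 * r ∸ 1) parts (toℕ j)) (#-part-replicate q r (toℕ j))
      ; cover = cover
      ; big   = λ {v} _ → subst (_≤ # (L′ v)) (proj₂ (isList v))
                  (length≤#-palette (suc M) (proj₁ (isList v)) λ x∈ →
                    s≤s (lookupᴬ (xs≤max 0 (concat (tabulateˡ L))) (∈-concat⁺′ x∈ (∈-tabulate⁺ {f = L} v))))
      }
    open Colouring (colouring q inst) renaming (colour to f)
    proper : Proper H (toℕ ∘ f)
    proper S (∣S∣≡r , spread) (a , mono)
      with v₀ , v₀∈ ← 0<#⇒nonempty {A = lookup S} (subst (0 <_) (sym (trans (#-lookup S) ∣S∣≡r)) (s≤s z≤n)) = absurd (class-tame (f v₀))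
      where
      colour-a : ∀ {v} → v ∈ lookup S → toℕ (f v) ≡ a
      colour-a {v} e = mono v (lookup⇒[]= v S e)
      S⊆class : lookup S ⊆ full ∩ fibre f (f v₀)
      S⊆class e = ∩⁺ refl (subst (_∈ ⁅ f v₀ ⁆) (toℕ-injective (trans (colour-a v₀∈) (sym (colour-a e)))) (self∈⁅⁆ _))
      -- A tame class contains no edge: it has fewer than `r` vertices or lies inside one part.
      absurd : ¬ Tame (suc s′) W P (full ∩ fibre f (f v₀))
      absurd (inj₁ le) = contradiction (≤-trans (#-mono S⊆class) le)
        (<⇒≱ (≤-reflexive (sym (trans (#-lookup S) ∣S∣≡r))))
      absurd (inj₂ (inj₁ ⊆W)) = spread 0 λ v v∈ → part⁻ sizes (⊆W (S⊆class ([]=⇒lookup v∈)))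
      absurd (inj₂ (inj₂ (j , ⊆P))) = spread _ λ v v∈ → part⁻ sizes (⊆P (S⊆class ([]=⇒lookup v∈)))

  -- r + 1 vertices with one colour would be spread over two parts, and so would some r of them.
  monochromatic-bound : ∀ {c} → Proper H c → ∀ {X a} → (∀ {v} → v ∈ X → c v ≡ a) →
                        (∀ i → # (X ∩ part sizes i) ≤ r) → # X ≤ r
  monochromatic-bound {c} proper {X} {a} mono thin = ≮⇒≥ λ r<X →
    let v₀ , v₀∈ = 0<#⇒nonempty {A = X} (≤-trans (s≤s z≤n) r<X)
        -- The part of `v₀` holds at most `r` vertices of `X`, so another part meets `X` too.
        v₁ , v₁∈ , v₁∉ = #<⇒witness {B = X} (≤-<-trans (thin (partOf sizes v₀)) r<X)
    in spread r<X v₀∈ v₁∈ v₁∉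
    where
    spread : ∀ {v₀ v₁} → r < # X → v₀ ∈ X → v₁ ∈ X → ¬ (v₁ ∉ X ∩ part sizes (partOf sizes v₀))
    spread {v₀} {v₁} r<X v₀∈ v₁∈ v₁∉
      -- Since `2 ≤ r`, the pair extends to `r` vertices of `X`; they form an edge because the pair
      -- already lies in two parts.
      with Z , Y⊆Z , Z⊆X , #Z ← subset-between {Y = ⁅ v₀ ⁆ ∪ ⁅ v₁ ⁆} {X = X} {r = r}
        (insert-⊆ v₀∈ λ e → subst (_∈ X) (sym (∈⁅⁆⁻ e)) v₁∈)
        (≤-trans (#-subadditive ∪⁻) (≤-trans (≤-reflexive (cong₂ _+_ (#-⁅⁆ v₀) (#-⁅⁆ v₁))) (s≤s (s≤s z≤n))))
        (<⇒≤ r<X)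
      = proper S (trans (sym (#-lookup S)) (trans #S #Z) , several) (a , λ v e → mono (Z⊆X (S⊆Z e)))
      where
      S = tabulate Z
      #S : # (lookup S) ≡ # Z
      #S = ≤-antisym (#-mono λ {v} e → trans (sym (lookup∘tabulate Z v)) e)
                     (#-mono λ {v} e → trans (lookup∘tabulate Z v) e)
      S⊆Z : ∀ {v} → v ∈ˢ S → v ∈ Z
      S⊆Z {v} e = trans (sym (lookup∘tabulate Z v)) ([]=⇒lookup e)
      Z⊆S : ∀ {v} → v ∈ Z → v ∈ˢ S
      Z⊆S {v} e = lookup⇒[]= v S (trans (lookup∘tabulate Z v) e)
      several : ∀ i → ¬ (∀ v → v ∈ˢ S → partOf sizes v ≡ i)
      several i one = ∈-∉ {A = X ∩ part sizes (partOf sizes v₀)}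
        (∩⁺ v₁∈ (part⁺ sizes (trans (one v₁ (Z⊆S (Y⊆Z (∪⁺ʳ (self∈⁅⁆ v₁)))))
                                    (sym (one v₀ (Z⊆S (Y⊆Z (∪⁺ˡ (self∈⁅⁆ v₀)))))))))
        v₁∉

  -- Lower bound from a set with at most r vertices in each part

  module Transversal {U₀ : FSet (order H)} (U₀⊆ : U₀ ⊆ part sizes 0) (#U₀ : # U₀ ≡ r) where

    U : FSet (order H)
    U = U₀ ∪ (full ─ part sizes 0)

    #-U : suc q * r ≤ # U
    #-U = begin
      r + q * r                          ≤⟨ +-mono-≤ (≤-reflexive (sym #U₀)) (+-cancelˡ-≤ (2 * r ∸ 1) _ _ rest) ⟩
      # U₀ + # (full ─ part sizes 0)     ≤⟨ #-superadditive ∪⁺ˡ ∪⁺ʳ disjoint ⟩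
      # U                                ∎
      where
      open ≤-Reasoning
      sum-parts : ∀ q → sumˡ (replicate q r) ≡ q * r
      sum-parts zero    = refl
      sum-parts (suc q) = cong (r +_) (sum-parts q)
      rest : 2 * r ∸ 1 + q * r ≤ 2 * r ∸ 1 + # (full ─ part sizes 0)
      rest = begin
        2 * r ∸ 1 + q * r                                  ≡⟨ cong (2 * r ∸ 1 +_) (sum-parts q) ⟨
        order H                                            ≡⟨ #-full ⟨
        # (full {order H})                                 ≤⟨ #-─ full (part sizes 0) ⟩
        # (full ∩ part sizes 0) + # (full ─ part sizes 0)
          ≤⟨ +-monoˡ-≤ _ (≤-trans (#-mono (λ e → proj₂ (∩⁻ e))) (≤-reflexive (#-part-zero (2 * r ∸ 1) parts))) ⟩
        2 * r ∸ 1 + # (full ─ part sizes 0)                ∎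
      disjoint : ∀ {v} → v ∈ U₀ → v ∉ (full ─ part sizes 0)
      disjoint {v} e with ∈-or-∉ (full ─ part sizes 0) v
      ... | inj₂ v∉ = v∉
      ... | inj₁ v∈ = ∈-∉ {A = part sizes 0} (U₀⊆ e) (proj₂ (─⁻ v∈))

    thin : ∀ i → # (U ∩ part sizes i) ≤ r
    thin zero = ≤-trans (#-mono inU₀) (≤-reflexive #U₀)
      where
      inU₀ : U ∩ part sizes 0 ⊆ U₀
      inU₀ e with u , p ← ∩⁻ e with ∪⁻ u
      ... | inj₁ e′ = e′
      ... | inj₂ e′ = ∈-∉ {A = part sizes 0} p (proj₂ (─⁻ e′))
    thin (suc i) = ≤-trans (#-mono (λ e → proj₂ (∩⁻ e)))
      (≤-trans (#-part-suc (2 * r ∸ 1) parts i) (#-part-replicate q r i))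

    -- Each vertex is joined only to the colour that it receives. Every class within `U` has at most
    -- `r` vertices by `monochromatic-bound`, and `U` has at least `suc q * r`.
    colours-needed : ∀ {c m} → Proper H c → (∀ v → c v < m) → suc q ≤ m
    colours-needed {c} {m} proper c< = *-cancelʳ-≤ (suc q) m r (begin
      suc q * r           ≤⟨ #-U ⟩
      # U                 ≡⟨ *-identityʳ (# U) ⟨
      # U * 1             ≤⟨ double-count L U full (λ {v} _ → has-colour v) (λ _ _ → refl) class ⟩
      # (full {m}) * r    ≡⟨ cong (_* r) #-full ⟩
      m * r               ∎)
      where
      open ≤-Reasoning
      L : Fin (order H) → FSet m
      L v = ⁅ fromℕ< (c< v) ⁆
      has-colour : ∀ v → 1 ≤ # (L v)
      has-colour v = ≤-reflexive (sym (#-⁅⁆ (fromℕ< (c< v))))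
      class : ∀ d → # (U ∩ λ v → L v d) ≤ r
      class d = monochromatic-bound proper {a = toℕ d}
        (λ {v} e → trans (sym (toℕ-fromℕ< (c< v)))
          (cong toℕ (sym (∈⁅⁆⁻ (proj₂ (∩⁻ {A = U} {B = λ v → L v d} e))))))
        (λ i → ≤-trans (#-mono (λ e → let x , p = ∩⁻ e in
          ∩⁺ (proj₁ (∩⁻ {A = U} {B = λ v → L v d} x)) p)) (thin i))

  not-choosable : ∀ m → m < suc q → ¬ Choosable H m
  not-choosable m m< choosable-m =
    let c , allowed , proper = choosable-m (λ _ → upTo m) (λ _ → upTo⁺ m , length-upTo m)
        U₀ , _ , U₀⊆ , #U₀ = subset-between {Y = ∅} {X = part sizes 0} {r = r}
          (λ e → contradiction e ∅⁻) (≤-trans (≤-reflexive #-∅) z≤n) large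
    in contradiction (Transversal.colours-needed U₀⊆ #U₀ proper (λ v → ∈-upTo⁻ (allowed v))) (<⇒≱ m<)
    where
    rearrange : ∀ s′ → suc (suc s′) + suc s′ ≡ suc s′ + (suc (suc s′) + 0)
    rearrange = solve-∀
    large : r ≤ # (part sizes 0)
    large = ≤-trans (m≤m+n r (suc s′))
      (≤-reflexive (trans (rearrange s′) (sym (#-part-zero (2 * r ∸ 1) parts))))

theorem4p5 : (r k : ℕ) → 2 ≤ r → 1 ≤ k → ListChromaticNumber≡ (K r k) k
theorem4p5 (suc (suc s′)) (suc q) _ _ = choosable s′ q , not-choosable s′ q
theorem4p5 (suc zero) _ (s≤s ()) _
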